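{- Let $\Sigma$ be an alphabet, let $(I_1,O_1)$ and $(I_2,O_2)$ be IO signatures of $\Sigma$ with $I_1\cup I_2=\Sigma$, let $A_1$ be an $I_1$-interface automaton and $A_2$ an $I_2$-interface automaton, and suppose that the composite interface automaton $A_1\parallel A_2$ is defined. Then $$\mathcal{C}_{A_1\parallel A_2}=\mathcal{C}_{A_1}\parallel\mathcal{C}_{A_2},$$ i.e. the interface hypercontract associated with the composition of the automata is the parallel composition of the interface hypercontracts associated with them.
   Context: An IO signature $(I,O)$ of an alphabet $\Sigma$ is a partition of $\Sigma$ into two disjoint (possibly empty) sets. A language $L\subseteq\Sigma^*$ is $I$-receptive if it is nonempty, prefix-closed, and for all $w\in L$, $w'\in I^*$ one has $w\circ w'\in L$ ($\circ$ is concatenation, of words and of languages). $\mathcal{L}_I$ is the set of $I$-receptive languages ordered by inclusion; $\mathcal{L}_\emptyset$ is the set of nonempty prefix-closed languages. For signatures with $I\cup I'=\Sigma$ (compatible), the composition of $L\in\mathcal{L}_I$ and $L'\in\mathcal{L}_{I'}$ is $L\times L'=L\cap L'$, regarded as an element of $\mathcal{L}_{I\cap I'}$. Interface automata. An $I$-interface automaton is a tuple $A=(Q,q_0,\to)$ with $Q$ a finite set of states, $q_0\in Q$ the initial state, and $\to\ \subseteq Q\times\Sigma\times Q$ a deterministic transition relation (for each state and symbol there is at most one next state). Its language $\ell(A)\in\mathcal{L}_\emptyset$ is the set of all words (including the empty word) labelling a finite path of transitions starting at $q_0$. Composition of automata. Let $A_i=(Q_i,q_{i,0},\to_i)$ be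 an $I_i$-interface automaton, $i\in\{1,2\}$, with $I_1\cup I_2=\Sigma$. On $Q_1\times Q_2$ let $(q_1,q_2)\xrightarrow{\sigma}_c(q_1',q_2')$ iff $q_1\xrightarrow{\sigma}_1 q_1'$ and $q_2\xrightarrow{\sigma}_2 q_2'$, for $\sigma\in\Sigma$. Let $N\subseteq Q_1\times Q_2$ (invalid states) be the smallest set such that: (a) $(q_1,q_2)\in N$ whenever there is $\sigma\in O_2$ such that $q_2$ has a $\sigma$-transition in $A_2$ but $q_1$ has no $\sigma$-transition in $A_1$, or there is $\sigma\in O_1$ such that $q_1$ has a $\sigma$-transition in $A_1$ but $q_2$ has no $\sigma$-transition in $A_2$; and (b) $(q_1,q_2)\in N$ whenever $(q_1,q_2)\xrightarrow{\sigma}_c(q_1',q_2')$ for some $\sigma\in O_1\cup O_2$ and some $(q_1',q_2')\in N$. Then $A_1\parallel A_2$ is the $(I_1\cap I_2)$-interface automaton (with signature $(I_1\cap I_2,O_1\cup O_2)$) with states $(Q_1\times Q_2)\setminus N$, initial state $(q_{1,0},q_{2,0})$, and the transitions of $\to_c$ whose source and target are both outside $N$. It is defined when $(q_{1,0},q_{2,0})\notin N$. Interface hypercontracts. For $\Gamma\subseteq\Sigma$ let $\mathrm{MissExt}(S,S,\Gamma)=\big((S\circ\Gamma)\setminus S\big)\circ\Sigma^*$. For $S\in\mathcal{L}_\emptyset$ and a signature $(I,O)$ put $E_S=S\cup\mathrm{MissExt}(S,S,O)\in\mathcal{L}_O$ and $M_S=S\cup\mathrm{MissExt}(S,S,I)\in\mathcal{L}_I$.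 The interface hypercontract $\mathcal{C}_S$ determined by $S$ and $(I,O)$ has environments $\mathcal{E}_S=\{E\in\mathcal{L}_O : E\subseteq E_S\}$, closed-system specification $\{N\in\mathcal{L}_\emptyset : N\subseteq S\}$, and implementations $\mathcal{I}_S=\{M\in\mathcal{L}_I : M\subseteq M_S\}$. For an $I$-interface automaton $A$, $\mathcal{C}_A$ is the interface hypercontract determined by $\ell(A)$ and $(I,O)$. Refinement $\mathcal{C}\le\mathcal{C}'$ means that every environment of $\mathcal{C}'$ is an environment of $\mathcal{C}$ and every implementation of $\mathcal{C}$ is an implementation of $\mathcal{C}'$. Parallel composition of interface hypercontracts. For sets $H,H'$ of receptive languages, write $H\parallel H'=\{N\times N' : N\in H, N'\in H'\}$. If $\mathcal{C}_S$, $\mathcal{C}_{S'}$ have signatures $(I,O)$, $(I',O')$ with $I\cup I'=\Sigma$, then $\mathcal{C}_S\parallel\mathcal{C}_{S'}$ is the smallest (with respect to refinement) interface hypercontract $\mathcal{C}_R$ with signature $(I\cap I',O\cup O')$, $R\in\mathcal{L}_\emptyset$, such that $\mathcal{I}_S\parallel\mathcal{I}_{S'}\subseteq\mathcal{I}_R$, $\mathcal{E}_R\parallel\mathcal{I}_S\subseteq\mathcal{E}_{S'}$ and $\mathcal{E}_R\parallel\mathcal{I}_{S'}\subseteq\mathcal{E}_S$, where $\mathcal{E}_R,\mathcal{I}_R$ are its environments and implementations. -}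

module Defs where

open import Axiom.ExcludedMiddle using (ExcludedMiddle)
open import Data.Empty using (⊥-elim) renaming (⊥ to False)
open import Data.List.Base using (List; []; _∷_; [_]; _++_; mapMaybe; cartesianProduct)
open import Data.List.Membership.Propositional using () renaming (_∈_ to _∈ˡ_)
open import Data.List.Properties using (++-assoc; ++-identityʳ; ∷-injective; ∷ʳ-injectiveʳ)
open import Data.List.Relation.Unary.All using (All; []; _∷_)
open import Data.List.Relation.Unary.Any using (here; there)
open import Data.List.Relation.Unary.Enumerates.Setoid using (IsEnumeration)
open import Data.List.Membership.Propositional.Properties using (∈-cartesianProduct⁺)
open import Data.Maybe.Base using (Maybe; just; nothing)
open import Data.Product.Base using (∃; ∃₂; _×_; _,_; proj₁; proj₂)
open import Data.Sum.Base using (_⊎_; inj₁; inj₂)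
open import Level using (0ℓ) renaming (suc to lsuc)
open import Relation.Binary.PropositionalEquality
  using (_≡_; refl; sym; subst; setoid)
open import Relation.Nullary using (¬_; yes; no)
open import Relation.Unary
  using (Pred; _∈_; _∉_; _⊆_; _≐_; _∪_; _∩_; _∖_; _⊥_; ∅; U; Satisfiable; Universal)

private
  variable
    Σ : Set

record Signature (Σ : Set) : Set₁ where
  field
    I O      : Pred Σ 0ℓ
    disjoint : I ⊥ O
    cover    : Universal (I ∪ O)

open Signature public using (I; O)

Compatible : Signature Σ → Signature Σ → Set
Compatible s₁ s₂ = Universal (I s₁ ∪ I s₂)

_∥ˢ_ : Signature Σ → Signature Σ → Signature Σ
s₁ ∥ˢ s₂ = record
  { I        = I s₁ ∩ I s₂
  ; O        = O s₁ ∪ O s₂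
  ; disjoint = λ { ((i₁ , i₂) , inj₁ o₁) → Signature.disjoint s₁ (i₁ , o₁)
                 ; ((i₁ , i₂) , inj₂ o₂) → Signature.disjoint s₂ (i₂ , o₂) }
  ; cover    = λ σ → split (Signature.cover s₁ σ) (Signature.cover s₂ σ)
  }
  where
  split : ∀ {σ} → σ ∈ I s₁ ∪ O s₁ → σ ∈ I s₂ ∪ O s₂ →
          σ ∈ (I s₁ ∩ I s₂) ∪ (O s₁ ∪ O s₂)
  split (inj₁ i₁) (inj₁ i₂) = inj₁ (i₁ , i₂)
  split (inj₁ _)  (inj₂ o₂) = inj₂ (inj₂ o₂)
  split (inj₂ o₁) _         = inj₂ (inj₁ o₁)

-- Languages are compared with _⊆_ and _≐_, never with _≡_.
Language : Set → Set₁
Language Σ = Pred (List Σ) 0ℓ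

infixr 8 _·_

_·_ : Language Σ → Language Σ → Language Σ
(L · L′) w = ∃₂ λ u v → u ∈ L × v ∈ L′ × w ≡ u ++ v

letters : Pred Σ 0ℓ → Language Σ
letters Γ w = ∃ λ σ → σ ∈ Γ × w ≡ [ σ ]

-- Γ* is All Γ; in particular Σ* is U.
record Receptive (Γ : Pred Σ 0ℓ) (L : Language Σ) : Set where
  field
    nonempty     : Satisfiable L
    prefixClosed : ∀ w v → w ++ v ∈ L → w ∈ L
    receptive    : ∀ w w′ → w ∈ L → w′ ∈ All Γ → w ++ w′ ∈ L

𝓛 : Pred Σ 0ℓ → Pred (Language Σ) 0ℓ
𝓛 = Receptive

missExt : Language Σ → Pred Σ 0ℓ → Language Σ
missExt S Γ = ((S · letters Γ) ∖ S) · U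

record Hypercontract (Σ : Set) : Set₁ where
  field
    environments closedSystems implementations : Pred (Language Σ) 0ℓ

open Hypercontract public

infix 4 _≈_ _≤_

_≈_ : Hypercontract Σ → Hypercontract Σ → Set₁
C ≈ D = environments C ≐ environments D
      × closedSystems C ≐ closedSystems D
      × implementations C ≐ implementations D

_≤_ : Hypercontract Σ → Hypercontract Σ → Set₁
C ≤ D = environments D ⊆ environments C × implementations C ⊆ implementations D

E⟨_⟩ M⟨_⟩ : Signature Σ → Language Σ → Language Σ
E⟨ s ⟩ S = S ∪ missExt S (O s)
M⟨ s ⟩ S = S ∪ missExt S (I s)

record InterfaceHypercontract {Σ : Set} (s : Signature Σ) : Set₁ where
  constructor determinedBy
  field
    S     : Language Σ
    S∈𝓛∅ : S ∈ 𝓛 ∅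

  hypercontract : Hypercontract Σ
  hypercontract = record
    { environments    = λ E → E ∈ 𝓛 (O s) × E ⊆ E⟨ s ⟩ S
    ; closedSystems   = λ N → N ∈ 𝓛 ∅ × N ⊆ S
    ; implementations = λ M → M ∈ 𝓛 (I s) × M ⊆ M⟨ s ⟩ S
    }

open InterfaceHypercontract public using (hypercontract)

-- The composition of languages is their intersection; compatibility of the
-- signatures only determines which 𝓛 it belongs to.
_∥ᴸ_ : Pred (Language Σ) 0ℓ → Pred (Language Σ) 0ℓ → Pred (Language Σ) (lsuc 0ℓ)
(H ∥ᴸ H′) L = ∃₂ λ N N′ → N ∈ H × N′ ∈ H′ × L ≐ N ∩ N′

-- The inclusions that D must satisfy to be a candidate for C ∥ C′.
record Admissible (C C′ D : Hypercontract Σ) : Set₁ where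
  field
    impl  : implementations C ∥ᴸ implementations C′ ⊆ implementations D
    envʳ  : environments D ∥ᴸ implementations C ⊆ environments C′
    envˡ  : environments D ∥ᴸ implementations C′ ⊆ environments C

-- D = C ∥ C′, i.e. D is the smallest admissible interface hypercontract; by
-- isParallelComposition-unique below, it is then the only one up to _≈_.
record IsParallelComposition
  {Σ : Set} {s s′ : Signature Σ}
  (C : InterfaceHypercontract s) (C′ : InterfaceHypercontract s′)
  (D : InterfaceHypercontract (s ∥ˢ s′)) : Set₁ where
  field
    admissible : Admissible (hypercontract C) (hypercontract C′) (hypercontract D)
    smallest   : ∀ (D′ : InterfaceHypercontract (s ∥ˢ s′)) →
                 Admissible (hypercontract C) (hypercontract C′) (hypercontract D′) →
                 hypercontract D ≤ hypercontract D′

Finite : Set → Set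
Finite A = ∃ λ xs → IsEnumeration (setoid A) xs

record InterfaceAutomaton (s : Signature Σ) : Set₁ where
  field
    Q             : Set
    finite        : Finite Q
    q₀            : Q
    _-[_]→_       : Q → Σ → Q → Set
    deterministic : ∀ {q σ r r′} → q -[ σ ]→ r → q -[ σ ]→ r′ → r ≡ r′

  Enabled : Σ → Q → Set
  Enabled σ q = ∃ λ r → q -[ σ ]→ r

  data Path : Q → List Σ → Q → Set where
    []  : ∀ {q} → Path q [] q
    _∷_ : ∀ {q r t σ w} → q -[ σ ]→ r → Path r w t → Path q (σ ∷ w) t

  ℓ : Language Σ
  ℓ w = ∃ λ q → Path q₀ w q

  ℓ∈𝓛∅ : ℓ ∈ 𝓛 ∅
  ℓ∈𝓛∅ = record
    { nonempty     = [] , q₀ , []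
    ; prefixClosed = λ w v (_ , p) → initial w p
    ; receptive    = λ { w [] w∈ℓ [] → subst ℓ (sym (++-identityʳ w)) w∈ℓ }
    }
    where
    initial : ∀ {q t v} w → Path q (w ++ v) t → ∃ λ r → Path q w r
    initial []      p       = _ , []
    initial (_ ∷ w) (x ∷ p) = let _ , p′ = initial w p in _ , x ∷ p′

open InterfaceAutomaton public using (Q; q₀; ℓ; ℓ∈𝓛∅)

𝓒 : {s : Signature Σ} → InterfaceAutomaton s → InterfaceHypercontract s
𝓒 A = determinedBy (ℓ A) (ℓ∈𝓛∅ A)

module _ {s₁ s₂ : Signature Σ}
         (A₁ : InterfaceAutomaton s₁) (A₂ : InterfaceAutomaton s₂) where

  private
    module A₁ = InterfaceAutomaton A₁
    module A₂ = InterfaceAutomaton A₂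

  Stepᶜ : Q A₁ × Q A₂ → Σ → Q A₁ × Q A₂ → Set
  Stepᶜ (q₁ , q₂) σ (r₁ , r₂) = q₁ A₁.-[ σ ]→ r₁ × q₂ A₂.-[ σ ]→ r₂

  data Invalid : Pred (Q A₁ × Q A₂) 0ℓ where
    refusal₁  : ∀ {q₁ q₂ σ} → σ ∈ O s₂ → A₂.Enabled σ q₂ → ¬ A₁.Enabled σ q₁ →
                Invalid (q₁ , q₂)
    refusal₂  : ∀ {q₁ q₂ σ} → σ ∈ O s₁ → A₁.Enabled σ q₁ → ¬ A₂.Enabled σ q₂ →
                Invalid (q₁ , q₂)
    propagate : ∀ {q r σ} → σ ∈ O s₁ ∪ O s₂ → Stepᶜ q σ r → Invalid r → Invalid q

  Defined : Set
  Defined = (q₀ A₁ , q₀ A₂) ∉ Invalid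

  -- Negations are definitionally proof-irrelevant, so this is a genuine subset
  -- of the product.
  ValidState : Set
  ValidState = ∃ λ q → q ∉ Invalid

  -- Classical, since Invalid need not be decidable.
  valid-finite : ExcludedMiddle 0ℓ → Finite ValidState
  valid-finite em with A₁.finite | A₂.finite
  ... | xs , enum₁ | ys , enum₂ =
    mapMaybe valid? (cartesianProduct xs ys) ,
    λ { (q , v) → keep v (∈-cartesianProduct⁺ (enum₁ (proj₁ q)) (enum₂ (proj₂ q))) }
    where
    valid? : Q A₁ × Q A₂ → Maybe ValidState
    valid? q with em {Invalid q}
    ... | yes _ = nothing
    ... | no v  = just (q , v)

    keep : ∀ {q qs} (v : q ∉ Invalid) → q ∈ˡ qs → (q , v) ∈ˡ mapMaybe valid? qs
    keep {q} v (here refl) with em {Invalid q}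
    ... | yes n = ⊥-elim (v n)
    ... | no _  = here refl
    keep {qs = q′ ∷ _} v (there q∈qs) with em {Invalid q′}
    ... | yes _ = keep v q∈qs
    ... | no _  = there (keep v q∈qs)

  compose : ExcludedMiddle 0ℓ → Defined → InterfaceAutomaton (s₁ ∥ˢ s₂)
  compose em defined = record
    { Q             = ValidState
    ; finite        = valid-finite em
    ; q₀            = (q₀ A₁ , q₀ A₂) , defined
    ; _-[_]→_       = λ (q , _) σ (r , _) → Stepᶜ q σ r
    ; deterministic = λ {q} {σ} {r} {r′} → determ {q} {r} {r′} {σ}
    }
    where
    determ : ∀ {q r r′ : ValidState} {σ} → Stepᶜ (proj₁ q) σ (proj₁ r) →
             Stepᶜ (proj₁ q) σ (proj₁ r′) → r ≡ r′
    determ (x₁ , x₂) (y₁ , y₂)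
      with refl ← A₁.deterministic x₁ y₁ | refl ← A₂.deterministic x₂ y₂ = refl

private
  comparable : ∀ (w x : List Σ) {v u} → w ++ v ≡ x ++ u →
               (∃ λ t → x ≡ w ++ t) ⊎ (∃ λ t → w ≡ x ++ t)
  comparable []      x       _    = inj₁ (x , refl)
  comparable (a ∷ w) []      _    = inj₂ (a ∷ w , refl)
  comparable (a ∷ w) (b ∷ x) eq with ∷-injective eq
  ... | refl , eq′ with comparable w x eq′
  ... | inj₁ (t , refl) = inj₁ (t , refl)
  ... | inj₂ (t , refl) = inj₂ (t , refl)

  prefix-∷ʳ : ∀ (s w : List Σ) {γ t} → s ++ [ γ ] ≡ w ++ t →
              (w ≡ s ++ [ γ ]) ⊎ (∃ λ t′ → s ≡ w ++ t′)
  prefix-∷ʳ s       []          _    = inj₂ (s , refl)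
  prefix-∷ʳ []      (a ∷ [])    refl = inj₁ refl
  prefix-∷ʳ []      (a ∷ _ ∷ _) ()
  prefix-∷ʳ (b ∷ s) (a ∷ w)     eq with ∷-injective eq
  ... | refl , eq′ with prefix-∷ʳ s w eq′
  ... | inj₁ refl       = inj₁ refl
  ... | inj₂ (t , refl) = inj₂ (t , refl)

-- Γ = O gives E_S ∈ 𝓛_O, and Γ = I gives M_S ∈ 𝓛_I.
saturation∈𝓛 : ExcludedMiddle 0ℓ → (Γ : Pred Σ 0ℓ) (S : Language Σ) →
               S ∈ 𝓛 ∅ → S ∪ missExt S Γ ∈ 𝓛 Γ
saturation∈𝓛 em Γ S S∈𝓛 = record
  { nonempty     = let w , w∈S = nonempty in w , inj₁ w∈S
  ; prefixClosed = closed
  ; receptive    = extend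
  }
  where
  open Receptive S∈𝓛

  closed : ∀ w v → w ++ v ∈ S ∪ missExt S Γ → w ∈ S ∪ missExt S Γ
  closed w v (inj₁ wv∈S) = inj₁ (prefixClosed w v wv∈S)
  closed w v (inj₂ (_ , u , (x@(s , _ , s∈S , (γ , _ , refl) , refl) , x∉S) , _ , eq))
    with comparable w (s ++ [ γ ]) eq
  ... | inj₂ (t , refl) = inj₂ (_ , t , (x , x∉S) , _ , refl)
  ... | inj₁ (t , eq′) with prefix-∷ʳ s w eq′
  ...   | inj₁ refl       = inj₂ (_ , [] , (x , x∉S) , _ , sym (++-identityʳ w))
  ...   | inj₂ (t′ , refl) = inj₁ (prefixClosed w t′ s∈S)

  extendS : ∀ w w′ → w ∈ S → w′ ∈ All Γ → w ++ w′ ∈ S ∪ missExt S Γ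
  extendS w []       w∈S []        = inj₁ (subst S (sym (++-identityʳ w)) w∈S)
  extendS w (a ∷ w′) w∈S (a∈Γ ∷ g) with em {w ++ [ a ] ∈ S}
  ... | yes wa∈S = subst (S ∪ missExt S Γ) (++-assoc w [ a ] w′) (extendS _ w′ wa∈S g)
  ... | no  wa∉S = inj₂ (w ++ [ a ] , w′ ,
                         ((w , [ a ] , w∈S , (a , a∈Γ , refl) , refl) , wa∉S) ,
                         _ , sym (++-assoc w [ a ] w′))

  extend : ∀ w w′ → w ∈ S ∪ missExt S Γ → w′ ∈ All Γ → w ++ w′ ∈ S ∪ missExt S Γ
  extend w w′ (inj₁ w∈S) g = extendS w w′ w∈S g
  extend w w′ (inj₂ (x , u , x∈ , _ , refl)) g =
    inj₂ (x , u ++ w′ , x∈ , _ , ++-assoc x u w′)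

E∩M⊆S : (s : Signature Σ) (S : Language Σ) → S ∈ 𝓛 ∅ → E⟨ s ⟩ S ∩ M⟨ s ⟩ S ⊆ S
E∩M⊆S s S S∈𝓛 (inj₁ w∈S , _)        = w∈S
E∩M⊆S s S S∈𝓛 (inj₂ _    , inj₁ w∈S) = w∈S
E∩M⊆S s S S∈𝓛
  ( inj₂ (_ , _ , ((t , _ , t∈S , (γ , γ∈O , refl) , refl) , tγ∉S) , _ , refl)
  , inj₂ (_ , _ , ((u , _ , u∈S , (δ , δ∈I , refl) , refl) , uδ∉S) , _ , eq)) =
  ⊥-elim (clash (comparable (t ++ [ γ ]) (u ++ [ δ ]) eq))
  where
  open Receptive S∈𝓛
  same : t ++ [ γ ] ≡ u ++ [ δ ] → False
  same e with refl ← ∷ʳ-injectiveʳ t u e = Signature.disjoint s (δ∈I , γ∈O)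

  clash : (∃ λ v → u ++ [ δ ] ≡ (t ++ [ γ ]) ++ v) ⊎
          (∃ λ v → t ++ [ γ ] ≡ (u ++ [ δ ]) ++ v) → False
  clash (inj₁ (_ , e)) with prefix-∷ʳ u (t ++ [ γ ]) e
  ... | inj₁ e′         = same e′
  ... | inj₂ (v , refl) = tγ∉S (prefixClosed _ v u∈S)
  clash (inj₂ (_ , e)) with prefix-∷ʳ t (u ++ [ δ ]) e
  ... | inj₁ e′         = same (sym e′)
  ... | inj₂ (v , refl) = uδ∉S (prefixClosed _ v t∈S)

≤-antisym : ExcludedMiddle 0ℓ → {s : Signature Σ} (C D : InterfaceHypercontract s) →
            hypercontract C ≤ hypercontract D → hypercontract D ≤ hypercontract C →
            hypercontract C ≈ hypercontract D
≤-antisym em {s} C D (E₁ , M₁) (E₂ , M₂) =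
  (E₂ , E₁) ,
  ((λ (l , N⊆S) → l , λ n → below C D E₂ M₁ (N⊆S n)) ,
   (λ (l , N⊆T) → l , λ n → below D C E₁ M₂ (N⊆T n))) ,
  (M₁ , M₂)
  where
  below : (C D : InterfaceHypercontract s) →
          environments (hypercontract C) ⊆ environments (hypercontract D) →
          implementations (hypercontract C) ⊆ implementations (hypercontract D) →
          InterfaceHypercontract.S C ⊆ InterfaceHypercontract.S D
  below (determinedBy S S∈𝓛) (determinedBy T T∈𝓛) E⊆ M⊆ w∈S = E∩M⊆S s T T∈𝓛
    ( proj₂ (E⊆ {E⟨ s ⟩ S} (saturation∈𝓛 em (O s) S S∈𝓛 , λ x → x)) (inj₁ w∈S)
    , proj₂ (M⊆ {M⟨ s ⟩ S} (saturation∈𝓛 em (I s) S S∈𝓛 , λ x → x)) (inj₁ w∈S))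

isParallelComposition-unique :
  ExcludedMiddle 0ℓ → {s s′ : Signature Σ} →
  {C : InterfaceHypercontract s} {C′ : InterfaceHypercontract s′} →
  (D D′ : InterfaceHypercontract (s ∥ˢ s′)) →
  IsParallelComposition C C′ D → IsParallelComposition C C′ D′ →
  hypercontract D ≈ hypercontract D′
isParallelComposition-unique em D D′ p p′ =
  ≤-antisym em D D′ (P.smallest D′ P′.admissible) (P′.smallest D P.admissible)
  where
  module P  = IsParallelComposition p
  module P′ = IsParallelComposition p′

-- Write S₁, S₂ and R for the languages of A₁, A₂ and A₁ ∥ A₂.  Validity of the
-- states of A₁ ∥ A₂ makes R closed under every output that the automaton owning
-- it can perform, and this closure alone gives admissibility.  For minimality,
-- let T be admissible: after a word of E_T no state is invalid, because
-- E_T ∩ M_{S₁} ⊆ E_{S₂} and E_T ∩ M_{S₂} ⊆ E_{S₁} exclude refusals, and E_T is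
-- closed under the outputs along which invalidity propagates.  Hence words of
-- E_T can leave R only through an output.

module Submission where

open import Defs
open import Axiom.ExcludedMiddle using (ExcludedMiddle)
open import Data.Empty using (⊥-elim)
open import Data.List.Base using ([]; [_]; _++_; initLast; _∷ʳ′_)
open import Data.List.Properties using (++-assoc; ++-identityʳ; ∷ʳ-injective)
open import Data.List.Relation.Unary.All as All using ([]; _∷_)
open import Data.Product.Base using (_,_; proj₁; proj₂)
open import Data.Sum.Base using (_⊎_; inj₁; inj₂; [_,_]′) renaming (swap to ⊎-swap)
open import Data.Unit.Base using (tt)
open import Function.Base using (id; _∘_)
open import Level using (0ℓ)
open import Relation.Binary.PropositionalEquality using (refl; sym; trans)
open import Relation.Nullary using (yes; no)
open import Relation.Unary
  using (Pred; _∈_; _∉_; _⊆_; _≐_; _∪_; _∩_; ∅; U)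

private
  variable
    Σ : Set
    Γ Δ Θ : Pred Σ 0ℓ
    K L S S′ R : Language Σ

-- Receptive languages and their saturation by missing extensions.

[]∈ : L ∈ 𝓛 Γ → [] ∈ L
[]∈ L∈𝓛 = let w , w∈L = nonempty in prefixClosed [] w w∈L
  where open Receptive L∈𝓛

receptive-∷ʳ : ∀ {w σ} → L ∈ 𝓛 Γ → w ∈ L → σ ∈ Γ → w ++ [ σ ] ∈ L
receptive-∷ʳ L∈𝓛 w∈L σ∈Γ = Receptive.receptive L∈𝓛 _ _ w∈L (σ∈Γ ∷ [])

∩-receptive : Θ ⊆ Γ → Θ ⊆ Δ → K ∈ 𝓛 Γ → L ∈ 𝓛 Δ → S ≐ K ∩ L → S ∈ 𝓛 Θ
∩-receptive Θ⊆Γ Θ⊆Δ K∈𝓛 L∈𝓛 (S⊆ , ⊆S) = record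
  { nonempty     = [] , ⊆S ([]∈ K∈𝓛 , []∈ L∈𝓛)
  ; prefixClosed = λ w v wv∈S → let wv∈K , wv∈L = S⊆ wv∈S in
      ⊆S (K.prefixClosed w v wv∈K , L.prefixClosed w v wv∈L)
  ; receptive    = λ w w′ w∈S w′∈Θ* → let w∈K , w∈L = S⊆ w∈S in
      ⊆S ( K.receptive w w′ w∈K (All.map Θ⊆Γ w′∈Θ*)
         , L.receptive w w′ w∈L (All.map Θ⊆Δ w′∈Θ*))
  }
  where
  module K = Receptive K∈𝓛
  module L = Receptive L∈𝓛

missExt⁺ : ∀ {p σ} v → p ∈ S → σ ∈ Γ → p ++ [ σ ] ∉ S →
           (p ++ [ σ ]) ++ v ∈ missExt S Γ
missExt⁺ v p∈S σ∈Γ pσ∉S =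
  _ , v , ((_ , _ , p∈S , (_ , σ∈Γ , refl) , refl) , pσ∉S) , tt , refl

missExt-++ : ∀ {w} v → w ∈ missExt S Γ → w ++ v ∈ missExt S Γ
missExt-++ v (x , u , x∈ , _ , refl) = x , u ++ v , x∈ , tt , ++-assoc x u v

-- The word at which a missing extension leaves `S` cannot be a prefix of `p`, by prefix-closure;
-- hence it is `p ++ [ σ ]` itself, and its last letter lies in `Γ`.
saturation-∷ʳ⁻ : ∀ {p σ} → S ∈ 𝓛 ∅ → p ∈ S → p ++ [ σ ] ∈ S ∪ missExt S Γ →
                 p ++ [ σ ] ∈ S ⊎ σ ∈ Γ
saturation-∷ʳ⁻ S∈𝓛 p∈S (inj₁ pσ∈S) = inj₁ pσ∈S
saturation-∷ʳ⁻ {p = p} S∈𝓛 p∈S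
  (inj₂ (_ , v , ((s , _ , s∈S , (γ , γ∈Γ , refl) , refl) , sγ∉S) , _ , eq))
  with initLast v
... | [] with refl , refl ← ∷ʳ-injective p s (trans eq (++-identityʳ _)) = inj₂ γ∈Γ
... | v′ ∷ʳ′ x
  with refl , refl ← ∷ʳ-injective p ((s ++ [ γ ]) ++ v′)
                       (trans eq (sym (++-assoc (s ++ [ γ ]) v′ [ x ])))
  = ⊥-elim (sγ∉S (Receptive.prefixClosed S∈𝓛 _ v′ p∈S))

-- Every word belongs to the saturation of S by the full alphabet, which
-- provides the letter at which a word leaves S.
⊆-saturation : ExcludedMiddle 0ℓ → S ∈ 𝓛 ∅ → L ∈ 𝓛 Δ →
               (∀ {p σ} → p ∈ S → p ++ [ σ ] ∈ L → p ++ [ σ ] ∈ S ⊎ σ ∈ Γ) →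
               L ⊆ S ∪ missExt S Γ
⊆-saturation {S = S} em S∈𝓛 L∈𝓛 exit {w} w∈L
  with Receptive.receptive (saturation∈𝓛 em U S S∈𝓛) [] w
         (inj₁ ([]∈ S∈𝓛)) (All.universal (λ _ → tt) w)
... | inj₁ w∈S = inj₁ w∈S
... | inj₂ (_ , v , ((_ , _ , p∈S , (_ , _ , refl) , refl) , pσ∉S) , _ , refl) =
  inj₂ (missExt⁺ v p∈S
    ([ ⊥-elim ∘ pσ∉S , id ]′ (exit p∈S (Receptive.prefixClosed L∈𝓛 _ v w∈L))) pσ∉S)

-- Receptiveness of `R` to `Γ` relative to `S`: it is applied to outputs, with `S` the language of
-- one automaton, and to shared inputs, with `S` an environment.
ClosedUnder : Pred Σ 0ℓ → Language Σ → Language Σ → Set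
ClosedUnder Γ S R = ∀ {p σ} → p ∈ R → σ ∈ Γ → p ++ [ σ ] ∈ S → p ++ [ σ ] ∈ R

output-∷ʳ⁻ : ∀ {p σ} (s : Signature Σ) → S ∈ 𝓛 ∅ → p ∈ S → σ ∈ O s →
             p ++ [ σ ] ∈ M⟨ s ⟩ S → p ++ [ σ ] ∈ S
output-∷ʳ⁻ s S∈𝓛 p∈S σ∈O pσ∈M =
  [ id , (λ σ∈I → ⊥-elim (Signature.disjoint s (σ∈I , σ∈O))) ]′
  (saturation-∷ʳ⁻ S∈𝓛 p∈S pσ∈M)

outputs⊆inputs : (s s′ : Signature Σ) → Compatible s s′ → O s ⊆ I s′
outputs⊆inputs s s′ compatible {σ} σ∈O with compatible σ
... | inj₁ σ∈I  = ⊥-elim (Signature.disjoint s (σ∈I , σ∈O))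
... | inj₂ σ∈I′ = σ∈I′

-- At the letter where a word of `L` leaves `R`, an output of either component is impossible: `M`
-- keeps the word in that component's language, and closure then keeps it in `R`. Only a shared
-- input remains.
implementations-∩ :
  ExcludedMiddle 0ℓ → (s s′ : Signature Σ) →
  S ∈ 𝓛 ∅ → S′ ∈ 𝓛 ∅ → R ∈ 𝓛 ∅ → R ⊆ S → R ⊆ S′ →
  ClosedUnder (O s) S R → ClosedUnder (O s′) S′ R →
  L ∈ 𝓛 Γ → L ⊆ M⟨ s ⟩ S ∩ M⟨ s′ ⟩ S′ → L ⊆ M⟨ s ∥ˢ s′ ⟩ R
implementations-∩ {R = R} {L = L} em s s′ S∈𝓛 S′∈𝓛 R∈𝓛 R⊆S R⊆S′ closed closed′ L∈𝓛 L⊆M =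
  ⊆-saturation em R∈𝓛 L∈𝓛 exit
  where
  exit : ∀ {p σ} → p ∈ R → p ++ [ σ ] ∈ L → p ++ [ σ ] ∈ R ⊎ σ ∈ I (s ∥ˢ s′)
  exit {σ = σ} p∈R pσ∈L with Signature.cover (s ∥ˢ s′) σ
  ... | inj₁ σ∈I          = inj₂ σ∈I
  ... | inj₂ (inj₁ σ∈O)  = inj₁ (closed p∈R σ∈O
    (output-∷ʳ⁻ s S∈𝓛 (R⊆S p∈R) σ∈O (proj₁ (L⊆M pσ∈L))))
  ... | inj₂ (inj₂ σ∈O′) = inj₁ (closed′ p∈R σ∈O′
    (output-∷ʳ⁻ s′ S′∈𝓛 (R⊆S′ p∈R) σ∈O′ (proj₂ (L⊆M pσ∈L))))

-- Within `M⟨ s ⟩ S`, a word leaving `R` by an output of `s` would still be in `S`, hence in `R`; so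
-- it leaves by an output of `s′`, and closure shows that it leaves `S′` there as well. A general
-- `Γ` lets the two components be exchanged.
environments-∩ :
  ExcludedMiddle 0ℓ → (s s′ : Signature Σ) →
  S ∈ 𝓛 ∅ → R ⊆ S → R ⊆ S′ →
  ClosedUnder (O s) S R → ClosedUnder (O s′) S′ R → Γ ⊆ O s ∪ O s′ →
  (R ∪ missExt R Γ) ∩ M⟨ s ⟩ S ⊆ E⟨ s′ ⟩ S′
environments-∩ em s s′ S∈𝓛 R⊆S R⊆S′ closed closed′ Γ⊆O (inj₁ w∈R , _) = inj₁ (R⊆S′ w∈R)
environments-∩ {S = S} {S′ = S′} em s s′ S∈𝓛 R⊆S R⊆S′ closed closed′ Γ⊆O
  (inj₂ (_ , v , ((p , _ , p∈R , (σ , σ∈Γ , refl) , refl) , pσ∉R) , _ , refl) , w∈M)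
  with Γ⊆O σ∈Γ
... | inj₁ σ∈O = ⊥-elim (pσ∉R (closed p∈R σ∈O (output-∷ʳ⁻ s S∈𝓛 (R⊆S p∈R) σ∈O
  (Receptive.prefixClosed (saturation∈𝓛 em (I s) S S∈𝓛) _ v w∈M))))
... | inj₂ σ∈O′ =
  inj₂ (missExt⁺ v (R⊆S′ p∈R) σ∈O′ (λ pσ∈S′ → pσ∉R (closed′ p∈R σ∈O′ pσ∈S′)))

-- Paths of deterministic automata and of their composition.

module _ {s : Signature Σ} (A : InterfaceAutomaton s) where
  open InterfaceAutomaton A hiding (Q; q₀; ℓ; ℓ∈𝓛∅)

  snoc : ∀ {q r t σ w} → Path q w r → r -[ σ ]→ t → Path q (w ++ [ σ ]) t
  snoc []      y = y ∷ []
  snoc (x ∷ p) y = x ∷ snoc p y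

  -- By determinism the longer path passes through `r`.
  enabled : ∀ {q r t σ w} → Path q w r → Path q (w ++ [ σ ]) t → Enabled σ r
  enabled []      (y ∷ []) = _ , y
  enabled (x ∷ p) (y ∷ p′) with refl ← deterministic x y = enabled p p′

module _ (em : ExcludedMiddle 0ℓ) {s₁ s₂ : Signature Σ} (compatible : Compatible s₁ s₂)
         (A₁ : InterfaceAutomaton s₁) (A₂ : InterfaceAutomaton s₂)
         (defined : Defined A₁ A₂) where

  private
    module A₁ = InterfaceAutomaton A₁
    module A₂ = InterfaceAutomaton A₂
    A = compose A₁ A₂ em defined
    module A = InterfaceAutomaton A

    M₁∈𝓛 : M⟨ s₁ ⟩ (ℓ A₁) ∈ 𝓛 (I s₁)
    M₁∈𝓛 = saturation∈𝓛 em (I s₁) (ℓ A₁) (ℓ∈𝓛∅ A₁)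

    M₂∈𝓛 : M⟨ s₂ ⟩ (ℓ A₂) ∈ 𝓛 (I s₂)
    M₂∈𝓛 = saturation∈𝓛 em (I s₂) (ℓ A₂) (ℓ∈𝓛∅ A₂)

    O₁⊆I₂ : O s₁ ⊆ I s₂
    O₁⊆I₂ = outputs⊆inputs s₁ s₂ compatible

    O₂⊆I₁ : O s₂ ⊆ I s₁
    O₂⊆I₁ = outputs⊆inputs s₂ s₁ (⊎-swap ∘ compatible)

  path₁ : ∀ {q r w} → A.Path q w r → A₁.Path (proj₁ (proj₁ q)) w (proj₁ (proj₁ r))
  path₁ A.[]      = A₁.[]
  path₁ (x A.∷ p) = proj₁ x A₁.∷ path₁ p

  path₂ : ∀ {q r w} → A.Path q w r → A₂.Path (proj₂ (proj₁ q)) w (proj₂ (proj₁ r))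
  path₂ A.[]      = A₂.[]
  path₂ (x A.∷ p) = proj₂ x A₂.∷ path₂ p

  ℓ-compose⊆₁ : ℓ A ⊆ ℓ A₁
  ℓ-compose⊆₁ (_ , p) = _ , path₁ p

  ℓ-compose⊆₂ : ℓ A ⊆ ℓ A₂
  ℓ-compose⊆₂ (_ , p) = _ , path₂ p

  -- The target is valid, since invalidity would propagate back along an output to the valid source.
  output-step : ∀ {w σ q₁ q₂} {v : (q₁ , q₂) ∉ Invalid A₁ A₂} →
                A.Path (q₀ A) w ((q₁ , q₂) , v) → σ ∈ O s₁ ∪ O s₂ →
                A₁.Enabled σ q₁ → A₂.Enabled σ q₂ → w ++ [ σ ] ∈ ℓ A
  output-step {v = v} p σ∈O (r₁ , x₁) (r₂ , x₂) =
    ((r₁ , r₂) , v ∘ propagate σ∈O (x₁ , x₂)) , snoc A p (x₁ , x₂)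

  closed₁ : ClosedUnder (O s₁) (ℓ A₁) (ℓ A)
  closed₁ {σ = σ} (((q₁ , q₂) , v) , p) σ∈O (_ , p₁)
    -- Validity only refutes a refusal by `A₂`; excluded middle turns this into an actual
    -- transition.
    with e₁ ← enabled A₁ (path₁ p) p₁ | em {A₂.Enabled σ q₂}
  ... | yes e₂ = output-step p (inj₁ σ∈O) e₁ e₂
  ... | no ¬e₂ = ⊥-elim (v (refusal₂ σ∈O e₁ ¬e₂))

  closed₂ : ClosedUnder (O s₂) (ℓ A₂) (ℓ A)
  closed₂ {σ = σ} (((q₁ , q₂) , v) , p) σ∈O (_ , p₂)
    with e₂ ← enabled A₂ (path₂ p) p₂ | em {A₁.Enabled σ q₁}
  ... | yes e₁ = output-step p (inj₂ σ∈O) e₁ e₂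
  ... | no ¬e₁ = ⊥-elim (v (refusal₁ σ∈O e₂ ¬e₁))

  compose-admissible :
    Admissible (hypercontract (𝓒 A₁)) (hypercontract (𝓒 A₂)) (hypercontract (𝓒 A))
  compose-admissible = record
    { impl = λ (_ , _ , (N∈𝓛 , N⊆M₁) , (N′∈𝓛 , N′⊆M₂) , L≐) →
        let L∈𝓛 = ∩-receptive proj₁ proj₂ N∈𝓛 N′∈𝓛 L≐ in
        L∈𝓛 ,
        implementations-∩ em s₁ s₂ (ℓ∈𝓛∅ A₁) (ℓ∈𝓛∅ A₂) (ℓ∈𝓛∅ A)
          ℓ-compose⊆₁ ℓ-compose⊆₂ closed₁ closed₂ L∈𝓛
          (λ w∈L → let w∈N , w∈N′ = proj₁ L≐ w∈L in N⊆M₁ w∈N , N′⊆M₂ w∈N′)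
    ; envʳ = λ (_ , _ , (N∈𝓛 , N⊆E) , (N′∈𝓛 , N′⊆M₁) , L≐) →
        ∩-receptive inj₂ O₂⊆I₁ N∈𝓛 N′∈𝓛 L≐ ,
        λ w∈L → let w∈N , w∈N′ = proj₁ L≐ w∈L in
          environments-∩ em s₁ s₂ (ℓ∈𝓛∅ A₁) ℓ-compose⊆₁ ℓ-compose⊆₂ closed₁ closed₂ id
            (N⊆E w∈N , N′⊆M₁ w∈N′)
    ; envˡ = λ (_ , _ , (N∈𝓛 , N⊆E) , (N′∈𝓛 , N′⊆M₂) , L≐) →
        ∩-receptive inj₁ O₁⊆I₂ N∈𝓛 N′∈𝓛 L≐ ,
        λ w∈L → let w∈N , w∈N′ = proj₁ L≐ w∈L in
          environments-∩ em s₂ s₁ (ℓ∈𝓛∅ A₂) ℓ-compose⊆₂ ℓ-compose⊆₁ closed₂ closed₁ ⊎-swap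
            (N⊆E w∈N , N′⊆M₂ w∈N′)
    }

  -- Languages subject to the environment conditions of admissibility.

  module _ {E : Language Σ} (E∈𝓛 : E ∈ 𝓛 (O s₁ ∪ O s₂))
           (E∩M₁⊆E₂ : E ∩ M⟨ s₁ ⟩ (ℓ A₁) ⊆ E⟨ s₂ ⟩ (ℓ A₂))
           (E∩M₂⊆E₁ : E ∩ M⟨ s₂ ⟩ (ℓ A₂) ⊆ E⟨ s₁ ⟩ (ℓ A₁)) where

    -- The second condition puts `w` in `E⟨ s₁ ⟩ (ℓ A₁)`, which meets `M⟨ s₁ ⟩ (ℓ A₁)` only within
    -- `ℓ A₁`.
    E∩M₁∩M₂⊆ℓ₁ : ∀ {w} → w ∈ E → w ∈ M⟨ s₁ ⟩ (ℓ A₁) → w ∈ M⟨ s₂ ⟩ (ℓ A₂) → w ∈ ℓ A₁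
    E∩M₁∩M₂⊆ℓ₁ w∈E w∈M₁ w∈M₂ =
      E∩M⊆S s₁ (ℓ A₁) (ℓ∈𝓛∅ A₁) (E∩M₂⊆E₁ (w∈E , w∈M₂) , w∈M₁)

    E∩M₁∩M₂⊆ℓ₂ : ∀ {w} → w ∈ E → w ∈ M⟨ s₁ ⟩ (ℓ A₁) → w ∈ M⟨ s₂ ⟩ (ℓ A₂) → w ∈ ℓ A₂
    E∩M₁∩M₂⊆ℓ₂ w∈E w∈M₁ w∈M₂ =
      E∩M⊆S s₂ (ℓ A₂) (ℓ∈𝓛∅ A₂) (E∩M₁⊆E₂ (w∈E , w∈M₁) , w∈M₂)

    -- Induction on the derivation of invalidity. In a refusal, the output extends `w` within `E`,
    -- within the sender's language and, being an input of the receiver, within the receiver's `M`;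
    -- so the receiver's language contains the extension, and the refused transition exists. In a
    -- propagation, `E` absorbs the output.
    environment⇒valid : ∀ {w q₁ q₂} → w ∈ E → A₁.Path (q₀ A₁) w q₁ →
                        A₂.Path (q₀ A₂) w q₂ → (q₁ , q₂) ∉ Invalid A₁ A₂
    environment⇒valid w∈E p₁ p₂ (refusal₁ σ∈O₂ (_ , x₂) ¬e₁) =
      ¬e₁ (enabled A₁ p₁ (proj₂ (E∩M₁∩M₂⊆ℓ₁
        (receptive-∷ʳ E∈𝓛 w∈E (inj₂ σ∈O₂))
        (receptive-∷ʳ M₁∈𝓛 (inj₁ (_ , p₁)) (O₂⊆I₁ σ∈O₂))
        (inj₁ (_ , snoc A₂ p₂ x₂)))))
    environment⇒valid w∈E p₁ p₂ (refusal₂ σ∈O₁ (_ , x₁) ¬e₂) =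
      ¬e₂ (enabled A₂ p₂ (proj₂ (E∩M₁∩M₂⊆ℓ₂
        (receptive-∷ʳ E∈𝓛 w∈E (inj₁ σ∈O₁))
        (inj₁ (_ , snoc A₁ p₁ x₁))
        (receptive-∷ʳ M₂∈𝓛 (inj₁ (_ , p₂)) (O₁⊆I₂ σ∈O₁)))))
    environment⇒valid w∈E p₁ p₂ (propagate σ∈O (x₁ , x₂) n) =
      environment⇒valid (receptive-∷ʳ E∈𝓛 w∈E σ∈O) (snoc A₁ p₁ x₁) (snoc A₂ p₂ x₂) n

    -- Receptiveness puts the extended word in `M` of both components; lying in `E`, it is then in
    -- both languages and reaches a valid state.
    input-closed : ClosedUnder (I s₁ ∩ I s₂) E (ℓ A)
    input-closed w∈ℓ@(_ , p) (σ∈I₁ , σ∈I₂) wσ∈E =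
      let wσ∈M₁  = receptive-∷ʳ M₁∈𝓛 (inj₁ (ℓ-compose⊆₁ w∈ℓ)) σ∈I₁
          wσ∈M₂  = receptive-∷ʳ M₂∈𝓛 (inj₁ (ℓ-compose⊆₂ w∈ℓ)) σ∈I₂
          _ , x₁ = enabled A₁ (path₁ p) (proj₂ (E∩M₁∩M₂⊆ℓ₁ wσ∈E wσ∈M₁ wσ∈M₂))
          _ , x₂ = enabled A₂ (path₂ p) (proj₂ (E∩M₁∩M₂⊆ℓ₂ wσ∈E wσ∈M₁ wσ∈M₂))
      in (_ , environment⇒valid wσ∈E (snoc A₁ (path₁ p) x₁) (snoc A₂ (path₂ p) x₂))
         , snoc A p (x₁ , x₂)

  compose-smallest :
    (D : InterfaceHypercontract (s₁ ∥ˢ s₂)) →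
    Admissible (hypercontract (𝓒 A₁)) (hypercontract (𝓒 A₂)) (hypercontract D) →
    hypercontract (𝓒 A) ≤ hypercontract D
  compose-smallest (determinedBy T T∈𝓛) admissible =
    (λ (E∈𝓛 , E⊆E_T) → E∈𝓛 , ⊆-saturation em (ℓ∈𝓛∅ A) E∈𝓛
      (λ p∈ℓ pσ∈E → exit p∈ℓ (E⊆E_T pσ∈E))) ,
    (λ (M∈𝓛 , M⊆M_R) → M∈𝓛 , λ w∈M → M_R⊆M_T (M⊆M_R w∈M))
    where
    open Admissible admissible
    s = s₁ ∥ˢ s₂

    E_T∈𝓛 : E⟨ s ⟩ T ∈ 𝓛 (O s)
    E_T∈𝓛 = saturation∈𝓛 em (O s) T T∈𝓛

    M_T∈𝓛 : M⟨ s ⟩ T ∈ 𝓛 (I s)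
    M_T∈𝓛 = saturation∈𝓛 em (I s) T T∈𝓛

    M₁∩M₂⊆M_T : M⟨ s₁ ⟩ (ℓ A₁) ∩ M⟨ s₂ ⟩ (ℓ A₂) ⊆ M⟨ s ⟩ T
    -- `impl` is applied to the largest implementation of each component.
    M₁∩M₂⊆M_T = proj₂ (impl (_ , _ , (M₁∈𝓛 , id) , (M₂∈𝓛 , id) , id , id))

    closed : ClosedUnder (I s₁ ∩ I s₂) (E⟨ s ⟩ T) (ℓ A)
    closed = input-closed E_T∈𝓛
      (proj₂ (envʳ (_ , _ , (E_T∈𝓛 , id) , (M₁∈𝓛 , id) , id , id)))
      (proj₂ (envˡ (_ , _ , (E_T∈𝓛 , id) , (M₂∈𝓛 , id) , id , id)))

    exit : ∀ {p σ} → p ∈ ℓ A → p ++ [ σ ] ∈ E⟨ s ⟩ T → p ++ [ σ ] ∈ ℓ A ⊎ σ ∈ O s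
    exit {σ = σ} p∈ℓ pσ∈E with Signature.cover s σ
    ... | inj₁ σ∈I = inj₁ (closed p∈ℓ σ∈I pσ∈E)
    ... | inj₂ σ∈O = inj₂ σ∈O

    ℓ⊆M_T : ℓ A ⊆ M⟨ s ⟩ T
    ℓ⊆M_T w∈ℓ = M₁∩M₂⊆M_T (inj₁ (ℓ-compose⊆₁ w∈ℓ) , inj₁ (ℓ-compose⊆₂ w∈ℓ))

    -- A word leaving `ℓ A` by a shared input stays in `M⟨ s ⟩ T` but is not in `T`, since `T` lies
    -- in `E⟨ s ⟩ T`, relative to which `ℓ A` is closed under inputs. So it is a missing extension
    -- of `T`, as are its continuations.
    M_R⊆M_T : M⟨ s ⟩ (ℓ A) ⊆ M⟨ s ⟩ T
    M_R⊆M_T (inj₁ w∈ℓ) = ℓ⊆M_T w∈ℓ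
    M_R⊆M_T (inj₂ (_ , v , ((_ , _ , p∈ℓ , (_ , σ∈I , refl) , refl) , pσ∉ℓ) , _ , refl))
      with receptive-∷ʳ M_T∈𝓛 (ℓ⊆M_T p∈ℓ) σ∈I
    ... | inj₁ pσ∈T = ⊥-elim (pσ∉ℓ (closed p∈ℓ σ∈I (inj₁ pσ∈T)))
    ... | inj₂ pσ∈X = inj₂ (missExt-++ v pσ∈X)

proposition9 : (em : ExcludedMiddle 0ℓ) →
    {Σ : Set} (s₁ s₂ : Signature Σ) → Compatible s₁ s₂ →
    (A₁ : InterfaceAutomaton s₁) (A₂ : InterfaceAutomaton s₂) →
    (defined : Defined A₁ A₂) →
    IsParallelComposition (𝓒 A₁) (𝓒 A₂) (𝓒 (compose A₁ A₂ em defined))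
proposition9 em s₁ s₂ compatible A₁ A₂ defined = record
  { admissible = compose-admissible em compatible A₁ A₂ defined
  ; smallest   = compose-smallest em compatible A₁ A₂ defined
  }
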